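{- Let $\mathcal K$ be the set of odd positive integers $k$ such that the sequence $(2^n k+1)_{n\ge 0}$ contains some Carmichael number. Then the smallest element of $\mathcal K$ is $27$.
   Context: A Carmichael number is a composite positive integer $N$ such that $a^N\equiv a\pmod N$ for all integers $a$. -}

module Defs where

open import Data.Integer.Base as ℤ using (ℤ; +_)
import Data.Integer.Divisibility as ℤ
open import Data.Nat.Base using (ℕ; _+_; _*_; _^_; _≤_; _<_)
open import Data.Nat.Divisibility using (_∤_)
open import Data.Nat.Primality using (Composite)
open import Data.Product.Base using (_×_; ∃-syntax)
open import Level using (0ℓ)
open import Relation.Unary using (Pred; _∈_)

infix 4 _≡_[mod_]

_≡_[mod_] : ℤ → ℤ → ℕ → Set
a ≡ b [mod N ] = (+ N) ℤ.∣ (a ℤ.- b)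

-- Positivity is part of Composite, which asks for a divisor d with 1 < d < N.
Carmichael : Pred ℕ 0ℓ
Carmichael N = Composite N × (∀ (a : ℤ) → (a ℤ.^ N) ≡ a [mod N ])

𝒦 : Pred ℕ 0ℓ
𝒦 k = 0 < k × 2 ∤ k × ∃[ n ] Carmichael (2 ^ n * k + 1)

_IsSmallestElementOf_ : ℕ → Pred ℕ 0ℓ → Set
m IsSmallestElementOf P = m ∈ P × (∀ k → k ∈ P → m ≤ k)

{-# OPTIONS --safe #-}
-- Let N = 2ⁿk + 1 be a Carmichael number with k odd. By Korselt's criterion N is squarefree and each of its prime
-- factors is 2ᵐd + 1 with m ≤ n and d ∣ k; call m its level. If P = 1 + 2ᵐc is the product of the prime factors of
-- level ≤ m and m < n, then N and N / P are both 1 modulo 2ᵐ⁺¹, so c is even; if m = n, then P = N and c = k. Going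
-- upwards from the lowest level m₀, one chooses at each level the set of new factors 2ᵐd + 1, subject to this parity
-- constraint and to the primality of these numbers, and for k < 27 every branch of this search dies.
-- Fermat primes (d = 1 ≠ k) occur only at levels below 6, since 2ᵐ ≡ -1 forces 2ᵐ + 1 to divide some k ± 2ˢ.
-- For m₀ < 130 the search is run with exact values of P. For m₀ ≥ 130 only P modulo 2^(m₀ + 125) matters, where
-- products of two terms 2ᵐd vanish, and divisibility of 2ᵐd + 1 by a small prime q depends only on m modulo the order
-- of 2; taking all q for which that order divides a fixed L leaves finitely many searches, one for each m₀ modulo L.
module Submission where

open import Data.Bool.Base using (Bool; true; false; if_then_else_; not; _∧_; _∨_; T)
open import Data.Bool.ListAction using (all)
open import Data.Bool.Properties using (∧-conicalˡ; ∧-conicalʳ; ∨-zeroʳ; ¬-not)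
open import Data.Empty using (⊥)
open import Data.Fin.Base as Fin using (toℕ; fromℕ; inject₁)
import Data.Fin.Properties as Fin
open import Data.Integer.Base as ℤ using (ℤ; +_; ∣_∣)
import Data.Integer.DivMod as ℤ
import Data.Integer.Divisibility.Signed as ℤ
import Data.Integer.Properties as ℤ
import Data.Integer.Tactic.RingSolver as ℤ-Solver
open import Data.List.Base using (List; []; _∷_; filter; length; replicate; upTo)
open import Data.List.Membership.Propositional using (_∈_)
open import Data.List.Membership.Propositional.Properties using (∈-filter⁺; ∈-filter⁻; ∈-upTo⁺)
open import Data.List.Properties using (length-replicate)
open import Data.List.Relation.Unary.All as All using (All; []; _∷_)
open import Data.List.Relation.Unary.Any using (here; there)
open import Data.Nat.Base
open import Data.Nat.Combinatorics using (_C_; nCk≡n!/k![n-k]!; k![n∸k]!∣n!; nCn≡1)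
open import Data.Nat.Coprimality as Coprimality using (Coprime; coprime-divisor)
open import Data.Nat.Divisibility
open import Data.Nat.DivMod
open import Data.Nat.GCD using (module Bézout; gcd; gcd-GCD; gcd[m,n]∣m; gcd[m,n]∣n; gcd[m,n]≢0)
open import Data.Nat.Induction using (<-rec)
open import Data.Nat.ListAction using (product)
open import Data.Nat.Primality
open import Data.Nat.Primality.Factorisation using (factorise)
open import Data.Nat.Properties
import Data.Nat.Tactic.RingSolver as ℕ-Solver
open import Data.Product.Base using (∃-syntax; _×_; _,_; proj₁; proj₂; map₁; map₂)
open import Data.Sum.Base as ⊎ using (_⊎_; inj₁; inj₂; [_,_]′)
open import Data.Unit.Base using (tt)
open import Data.Vec.Functional using (Vector)
open import Function.Base using (case_of_)
open import Relation.Binary.PropositionalEquality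
open import Relation.Nullary
open import Relation.Nullary.Decidable using (from-yes; from-no; dec-true; dec-false)
open import Relation.Unary using (Decidable)
import Algebra.Properties.CommutativeSemiring.Binomial +-*-commutativeSemiring as Binomial
import Algebra.Properties.Semiring.Exp +-*-semiring as Exp
import Algebra.Properties.Semiring.Mult +-*-semiring as Mult
import Algebra.Properties.Semiring.Sum +-*-semiring as Sum

open import Defs

-- Binomial coefficients modulo a prime.

prime∤! : ∀ {p} → Prime p → ∀ k → k < p → p ∤ k !
prime∤! pr zero k<p p∣1 = ¬prime[1] (subst Prime (∣1⇒≡1 p∣1) pr)
prime∤! pr (suc k) k<p p∣ with euclidsLemma (suc k) (k !) pr p∣
... | inj₁ p∣k = <⇒≱ k<p (∣⇒≤ p∣k)
... | inj₂ p∣k! = prime∤! pr k (<-trans (n<1+n k) k<p) p∣k!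

-- The prime divides `p !`, which is `p C k` times `k ! * (p ∸ k) !`, but it divides neither of
-- these two factorials.
prime∣C : ∀ {p k} → Prime p → 0 < k → k < p → p ∣ p C k
prime∣C {p@(suc _)} {k} pr 0<k k<p with euclidsLemma (p C k) (k ! * (p ∸ k) !) pr p∣C*d
  where
  instance _ = k !* (p ∸ k) !≢0
  p∣C*d : p ∣ (p C k) * (k ! * (p ∸ k) !)
  p∣C*d = subst (p ∣_) (sym (trans (cong (_* (k ! * (p ∸ k) !)) (nCk≡n!/k![n-k]! (<⇒≤ k<p)))
    (m/n*n≡m (k![n∸k]!∣n! (<⇒≤ k<p))))) (m∣m*n (pred p !))
... | inj₁ p∣C = p∣C
... | inj₂ p∣d with euclidsLemma (k !) ((p ∸ k) !) pr p∣d
...   | inj₁ p∣k! = contradiction p∣k! (prime∤! pr k k<p)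
...   | inj₂ p∣l! = contradiction p∣l! (prime∤! pr (p ∸ k) (∸-monoʳ-< 0<k (<⇒≤ k<p)))

∣-sum : ∀ {d n} (t : Vector ℕ n) → (∀ i → d ∣ t i) → d ∣ Sum.sum t
∣-sum {n = zero} t d∣t = _ ∣0
∣-sum {n = suc n} t d∣t = ∣m∣n⇒∣m+n (d∣t Fin.zero) (∣-sum (λ i → t (Fin.suc i)) (λ i → d∣t (Fin.suc i)))

×≡* : ∀ n x → n Mult.× x ≡ n * x
×≡* zero x = refl
×≡* (suc n) x = cong (λ z → x + z) (×≡* n x)

Exp≡^ : ∀ x n → x Exp.^ n ≡ x ^ n
Exp≡^ x zero = refl
Exp≡^ x (suc n) = cong (x *_) (Exp≡^ x n)

-- The inner binomial terms are collected into a multiple of `p`, so that the identity holds in the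
-- natural numbers.
freshman's-dream : ∀ {p} → Prime p → ∀ x y → ∃[ z ] (x + y) ^ p ≡ x ^ p + y ^ p + z * p
freshman's-dream {suc zero} pr = contradiction pr ¬prime[1]
freshman's-dream {p@(suc (suc n))} pr x y = quotient p∣middle , (begin
  (x + y) ^ p                             ≡⟨ Exp≡^ (x + y) p ⟨
  (x + y) Exp.^ p                         ≡⟨ Binomial.theorem p x y ⟩
  t Fin.zero + Sum.sum tail               ≡⟨ cong (λ z → t Fin.zero + z) (Sum.sum-init-last tail) ⟩
  t Fin.zero + (middle + t (fromℕ p))     ≡⟨ cong₂ (λ a b → a + (middle + b)) first last ⟩
  y ^ p + (middle + x ^ p)                ≡⟨ regroup (y ^ p) middle (x ^ p) ⟩
  x ^ p + y ^ p + middle                  ≡⟨ cong (λ z → x ^ p + y ^ p + z) (_∣_.equality p∣middle) ⟩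
  x ^ p + y ^ p + quotient p∣middle * p   ∎)
  where
  open ≡-Reasoning
  regroup : ∀ a m b → a + (m + b) ≡ b + a + m
  regroup = ℕ-Solver.solve-∀
  t : Vector ℕ (suc p)
  t = Binomial.binomialTerm x y p
  tail : Vector ℕ p
  tail i = t (Fin.suc i)
  middle : ℕ
  middle = Sum.sum (λ i → tail (inject₁ i))
  first : t Fin.zero ≡ y ^ p
  first = trans (+-identityʳ _) (trans (+-identityʳ _) (Exp≡^ y p))
  last : t (fromℕ p) ≡ x ^ p
  last = trans (cong (λ j → (p C j) Mult.× (x Exp.^ j * y Exp.^ (p ∸ j))) (Fin.toℕ-fromℕ p))
        (trans (cong₂ (λ c j → c Mult.× (x Exp.^ p * y Exp.^ j)) (nCn≡1 p) (n∸n≡0 p))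
        (trans (+-identityʳ _) (trans (*-identityʳ _) (Exp≡^ x p))))
  p∣middle : p ∣ middle
  p∣middle = ∣-sum _ λ i → let j = suc (toℕ (inject₁ i)) in
    subst (p ∣_) (sym (×≡* (p C j) (x Exp.^ j * y Exp.^ (p ∸ j))))
      (∣m⇒∣m*n _ (prime∣C {p} {j} pr z<s (s<s (subst (_< suc n) (sym (Fin.toℕ-inject₁ i)) (Fin.toℕ<n i)))))

-- Congruences of integers and Fermat's little theorem.

-- A record, unlike the synonym in Defs, lets unification recover both sides.
infix 4 _≈_[mod_]
record _≈_[mod_] (a b m : ℤ) : Set where
  constructor congruent
  field difference : m ℤ.∣ (a ℤ.- b)
open _≈_[mod_]

≈-reflexive : ∀ {m a b} → a ≡ b → a ≈ b [mod m ]
≈-reflexive {a = a} refl = congruent (ℤ.divides (+ 0) (ℤ.+-inverseʳ a))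

≈-refl : ∀ {m a} → a ≈ a [mod m ]
≈-refl = ≈-reflexive refl

≈-sym : ∀ {m a b} → a ≈ b [mod m ] → b ≈ a [mod m ]
≈-sym {m} {a} {b} (congruent (ℤ.divides q eq)) = congruent (ℤ.divides (ℤ.- q)
  (trans (flip a b) (trans (cong ℤ.-_ eq) (ℤ.neg-distribˡ-* q m))))
  where
  flip : ∀ a b → b ℤ.- a ≡ ℤ.- (a ℤ.- b)
  flip = ℤ-Solver.solve-∀

≈-trans : ∀ {m a b c} → a ≈ b [mod m ] → b ≈ c [mod m ] → a ≈ c [mod m ]
≈-trans {m} {a} {b} {c} (congruent p) (congruent q) =
  congruent (subst (m ℤ.∣_) (telescope a b c) (ℤ.∣m∣n⇒∣m+n p q))
  where
  telescope : ∀ a b c → (a ℤ.- b) ℤ.+ (b ℤ.- c) ≡ a ℤ.- c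
  telescope = ℤ-Solver.solve-∀

+-cong-≈ : ∀ {m a b c d} → a ≈ b [mod m ] → c ≈ d [mod m ] → a ℤ.+ c ≈ b ℤ.+ d [mod m ]
+-cong-≈ {m} {a} {b} {c} {d} (congruent p) (congruent q) =
  congruent (subst (m ℤ.∣_) (regroup a b c d) (ℤ.∣m∣n⇒∣m+n p q))
  where
  regroup : ∀ a b c d → (a ℤ.- b) ℤ.+ (c ℤ.- d) ≡ (a ℤ.+ c) ℤ.- (b ℤ.+ d)
  regroup = ℤ-Solver.solve-∀

*-cong-≈ : ∀ {m a b c d} → a ≈ b [mod m ] → c ≈ d [mod m ] → a ℤ.* c ≈ b ℤ.* d [mod m ]
*-cong-≈ {m} {a} {b} {c} {d} (congruent p) (congruent q) =
  congruent (subst (m ℤ.∣_) (regroup a b c d) (ℤ.∣m∣n⇒∣m+n (ℤ.∣n⇒∣m*n c p) (ℤ.∣n⇒∣m*n b q)))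
  where
  regroup : ∀ a b c d → c ℤ.* (a ℤ.- b) ℤ.+ b ℤ.* (c ℤ.- d) ≡ a ℤ.* c ℤ.- b ℤ.* d
  regroup = ℤ-Solver.solve-∀

^-cong-≈ : ∀ {m a b} n → a ≈ b [mod m ] → a ℤ.^ n ≈ b ℤ.^ n [mod m ]
^-cong-≈ zero p = ≈-reflexive refl
^-cong-≈ (suc n) p = *-cong-≈ p (^-cong-≈ n p)

pos-^ : ∀ a n → + (a ^ n) ≡ (+ a) ℤ.^ n
pos-^ a zero = refl
pos-^ a (suc n) = trans (ℤ.pos-* a (a ^ n)) (cong (+ a ℤ.*_) (pos-^ a n))

i+j-i≡j : ∀ i j → (i ℤ.+ j) ℤ.- i ≡ j
i+j-i≡j = ℤ-Solver.solve-∀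

-- Induction on `a`, since `(1 + a) ^ p` is `1 + a ^ p` modulo `p`.
fermat-ℕ : ∀ {p} → Prime p → ∀ a → + (a ^ p) ≈ + a [mod + p ]
fermat-ℕ {suc p} pr zero = ≈-reflexive refl
fermat-ℕ {p} pr (suc a) with freshman's-dream pr 1 a
... | z , eq = ≈-trans (congruent (ℤ.divides (+ z) step)) (+-cong-≈ {a = + 1} ≈-refl (fermat-ℕ pr a))
  where
  step : + (suc a ^ p) ℤ.- (+ 1 ℤ.+ + (a ^ p)) ≡ + z ℤ.* + p
  step = begin
    + (suc a ^ p) ℤ.- + (1 + a ^ p)         ≡⟨ cong (λ x → + x ℤ.- + (1 + a ^ p)) eq ⟩
    + (1 ^ p + a ^ p + z * p) ℤ.- + (1 + a ^ p)
      ≡⟨ cong (λ x → + (x + a ^ p + z * p) ℤ.- + (1 + a ^ p)) (^-zeroˡ p) ⟩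
    + (1 + a ^ p + z * p) ℤ.- + (1 + a ^ p) ≡⟨ cong (ℤ._- + (1 + a ^ p)) (ℤ.pos-+ (1 + a ^ p) (z * p)) ⟩
    (+ (1 + a ^ p) ℤ.+ + (z * p)) ℤ.- + (1 + a ^ p) ≡⟨ i+j-i≡j (+ (1 + a ^ p)) (+ (z * p)) ⟩
    + (z * p)                               ≡⟨ ℤ.pos-* z p ⟩
    + z ℤ.* + p                             ∎
    where open ≡-Reasoning

fermat : ∀ {p} → Prime p → ∀ a → a ℤ.^ p ≈ a [mod + p ]
fermat {p} pr a = ≈-trans (^-cong-≈ p a≈r)
  (≈-trans (≈-reflexive (sym (pos-^ r p))) (≈-trans (fermat-ℕ pr r) (≈-sym a≈r)))
  where
  instance _ = prime⇒nonZero pr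
  r = a ℤ.%ℕ p
  a≈r : a ≈ + r [mod + p ]
  a≈r = congruent (ℤ.divides (a ℤ./ℕ p) (trans (cong (ℤ._- + r) (ℤ.a≡a%ℕn+[a/ℕn]*n a p)) (i+j-i≡j (+ r) _)))

-- Roots of monic polynomials modulo a prime.

-- The list [c₀,…,cₙ₋₁] stands for the monic polynomial c₀ + … + cₙ₋₁xⁿ⁻¹ + xⁿ.
eval : List ℤ → ℤ → ℤ
eval [] x = + 1
eval (c ∷ cs) x = c ℤ.+ x ℤ.* eval cs x

-- Coefficients of (f(x) - f(a)) / (x - a) for f = c + x cs, whatever the constant c.
deflate : List ℤ → ℤ → List ℤ
deflate [] a = []
deflate (c ∷ cs) a = eval (c ∷ cs) a ∷ deflate cs a

length-deflate : ∀ cs a → length (deflate cs a) ≡ length cs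
length-deflate [] a = refl
length-deflate (c ∷ cs) a = cong suc (length-deflate cs a)

eval-deflate : ∀ c cs a x →
  eval (c ∷ cs) x ℤ.- eval (c ∷ cs) a ≡ (x ℤ.- a) ℤ.* eval (deflate cs a) x
eval-deflate c [] a x = linear c a x (+ 1)
  where
  linear : ∀ c a x u → (c ℤ.+ x ℤ.* u) ℤ.- (c ℤ.+ a ℤ.* u) ≡ (x ℤ.- a) ℤ.* u
  linear = ℤ-Solver.solve-∀
eval-deflate c (c′ ∷ cs) a x = trans (split c a x F Fa)
  (trans (cong (λ y → x ℤ.* y ℤ.+ (x ℤ.- a) ℤ.* Fa) (eval-deflate c′ cs a x)) (merge a x Fa _))
  where
  F = eval (c′ ∷ cs) x
  Fa = eval (c′ ∷ cs) a
  split : ∀ c a x u v → (c ℤ.+ x ℤ.* u) ℤ.- (c ℤ.+ a ℤ.* v) ≡ x ℤ.* (u ℤ.- v) ℤ.+ (x ℤ.- a) ℤ.* v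
  split = ℤ-Solver.solve-∀
  merge : ∀ a x v q → x ℤ.* ((x ℤ.- a) ℤ.* q) ℤ.+ (x ℤ.- a) ℤ.* v ≡ (x ℤ.- a) ℤ.* (v ℤ.+ x ℤ.* q)
  merge = ℤ-Solver.solve-∀

euclid-ℤ : ∀ {p} → Prime p → ∀ a b → + p ℤ.∣ a ℤ.* b → + p ℤ.∣ a ⊎ + p ℤ.∣ b
euclid-ℤ {p} pr a b p∣ab = ⊎.map ℤ.∣ᵤ⇒∣ ℤ.∣ᵤ⇒∣
  (euclidsLemma ∣ a ∣ ∣ b ∣ pr (subst (p ∣_) (ℤ.abs-* a b) (ℤ.∣⇒∣ᵤ p∣ab)))

-- Lagrange's bound on the number of roots, for consecutive roots 1, …, n + 1.
monic-roots : ∀ {p} → Prime p → ∀ n cs → length cs ≡ n → suc n < p →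
  ¬ (∀ i → 1 ≤ i → i ≤ suc n → + p ℤ.∣ eval cs (+ i))
monic-roots {p} pr zero [] len n<p root =
  ¬prime[1] (subst Prime (∣1⇒≡1 (ℤ.∣⇒∣ᵤ (root 1 ≤-refl ≤-refl))) pr)
monic-roots {p} pr (suc n) (c ∷ cs) len n<p root =
  monic-roots pr n (deflate cs a) (trans (length-deflate cs a) (suc-injective len))
    (<-trans (n<1+n _) n<p) root′
  where
  a = + suc (suc n)
  -- Deflating by the last root `a`: `p` divides `i - a` times the quotient at `i`, and
  -- `0 < a - i < p`.
  root′ : ∀ i → 1 ≤ i → i ≤ suc n → + p ℤ.∣ eval (deflate cs a) (+ i)
  root′ i 1≤i i≤n with euclid-ℤ pr (+ i ℤ.- a) _ (subst (+ p ℤ.∣_) (eval-deflate c cs a (+ i))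
    (ℤ.∣m∣n⇒∣m-n (root i 1≤i (m≤n⇒m≤1+n i≤n)) (root (suc (suc n)) (s≤s z≤n) ≤-refl)))
  ... | inj₂ p∣q = p∣q
  ... | inj₁ p∣i-a = contradiction (∣⇒≤ p∣gap) (<⇒≱ (≤-<-trans (m∸n≤m _ i) n<p))
    where
    instance _ = >-nonZero (m<n⇒0<n∸m (s≤s i≤n))
    p∣gap : p ∣ suc (suc n) ∸ i
    p∣gap = subst (p ∣_) (trans (cong ∣_∣ (trans (ℤ.m-n≡m⊖n i (suc (suc n))) (ℤ.⊖-≤ (m≤n⇒m≤1+n i≤n))))
      (ℤ.∣-i∣≡∣i∣ (+ (suc (suc n) ∸ i)))) (ℤ.∣⇒∣ᵤ p∣i-a)

power-poly : ∀ g x → eval (ℤ.- + 1 ∷ replicate g (+ 0)) x ≡ x ℤ.^ suc g ℤ.- + 1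
power-poly g x = trans (cong (λ y → ℤ.- + 1 ℤ.+ x ℤ.* y) (monomial g)) (ℤ.+-comm (ℤ.- + 1) (x ℤ.^ suc g))
  where
  monomial : ∀ g → eval (replicate g (+ 0)) x ≡ x ℤ.^ g
  monomial zero = refl
  monomial (suc g) = trans (ℤ.+-identityˡ _) (cong (x ℤ.*_) (monomial g))

-- Otherwise `x ^ g - 1`, monic of degree `g`, would have the `g + 1` roots 1, ..., `g + 1` modulo
-- `p`.
exponent≥p-1 : ∀ {p} → Prime p → ∀ g → 0 < g →
  (∀ i → 1 ≤ i → i < p → (+ i) ℤ.^ g ≈ + 1 [mod + p ]) → p ≤ suc g
exponent≥p-1 {p} pr (suc g) _ unit = ≮⇒≥ λ 1+g<p →
  monic-roots pr (suc g) (ℤ.- + 1 ∷ replicate g (+ 0)) (cong suc (length-replicate g)) 1+g<p λ i 1≤i i≤g →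
    subst (+ p ℤ.∣_) (sym (power-poly g (+ i))) (difference (unit i 1≤i (≤-<-trans i≤g 1+g<p)))

-- Korselt's criterion.

^-cancel : ∀ {p} → Prime p → ∀ i n → 1 ≤ i → i < p →
  (+ i) ℤ.^ suc n ≈ + i [mod + p ] → (+ i) ℤ.^ n ≈ + 1 [mod + p ]
^-cancel {p} pr i n 1≤i i<p eq with euclid-ℤ pr (+ i) ((+ i) ℤ.^ n ℤ.- + 1)
  (subst (+ p ℤ.∣_) (trans (cong (λ y → (+ i) ℤ.^ suc n ℤ.- y) (sym (ℤ.*-identityʳ (+ i)))) (factor (+ i) _ (+ 1)))
    (difference eq))
  where
  factor : ∀ x y u → x ℤ.* y ℤ.- x ℤ.* u ≡ x ℤ.* (y ℤ.- u)
  factor = ℤ-Solver.solve-∀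
... | inj₁ p∣i = contradiction (∣⇒≤ (ℤ.∣⇒∣ᵤ p∣i)) (<⇒≱ i<p)
  where instance _ = >-nonZero 1≤i
... | inj₂ p∣ = congruent p∣

power≈1 : ∀ {m a} n x → a ℤ.^ n ≈ + 1 [mod m ] → a ℤ.^ (x * n) ≈ + 1 [mod m ]
power≈1 {m} {a} n x p = ≈-trans (≈-reflexive (trans (cong (a ℤ.^_) (*-comm x n)) (sym (ℤ.^-*-assoc a n x))))
  (≈-trans (^-cong-≈ x p) (≈-reflexive (ℤ.^-zeroˡ x)))

-- `a ^ d` is congruent to `a ^ (d + y * t)`, which equals `a ^ (x * s)`; Bézout in this form avoids
-- inverting `a`.
bézout-power : ∀ {m a d s t} x y → d + y * t ≡ x * s →
  a ℤ.^ s ≈ + 1 [mod m ] → a ℤ.^ t ≈ + 1 [mod m ] → a ℤ.^ d ≈ + 1 [mod m ]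
bézout-power {m} {a} {d} {s} {t} x y eq ps pt =
  ≈-trans (≈-reflexive (sym (ℤ.*-identityʳ _)))
  (≈-trans (*-cong-≈ {a = a ℤ.^ d} ≈-refl (≈-sym (power≈1 t y pt)))
  (≈-trans (≈-reflexive (trans (sym (ℤ.^-distribˡ-+-* a d (y * t))) (cong (a ℤ.^_) eq)))
  (power≈1 s x ps)))

gcd-power : ∀ {m a} s t → a ℤ.^ s ≈ + 1 [mod m ] → a ℤ.^ t ≈ + 1 [mod m ] → a ℤ.^ gcd s t ≈ + 1 [mod m ]
gcd-power s t ps pt with Bézout.identity (gcd-GCD s t)
... | Bézout.Identity.+- x y eq = bézout-power {s = s} {t = t} x y eq ps pt
... | Bézout.Identity.-+ x y eq = bézout-power {s = t} {t = s} y x eq pt ps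

-- Every nonzero residue has `a ^ gcd q n` congruent to 1, and Lagrange's bound then forces
-- `gcd q n` to be `q`.
p-1∣n : ∀ {q} → Prime (suc q) → ∀ n → (∀ a → a ℤ.^ suc n ≈ a [mod + suc q ]) → q ∣ n
p-1∣n {zero} pr = contradiction pr ¬prime[1]
p-1∣n {suc q} pr n h = subst (_∣ n) g≡q (gcd[m,n]∣n (suc q) n)
  where
  g = gcd (suc q) n
  g>0 : 0 < g
  g>0 = n≢0⇒n>0 (gcd[m,n]≢0 (suc q) n (inj₁ λ ()))
  g≡q : g ≡ suc q
  g≡q = ≤-antisym (∣⇒≤ (gcd[m,n]∣m (suc q) n)) (s≤s⁻¹ (exponent≥p-1 pr g g>0 λ i 1≤i i<p →
    gcd-power (suc q) n (^-cancel pr i (suc q) 1≤i i<p (fermat pr (+ i))) (^-cancel pr i n 1≤i i<p (h (+ i)))))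

carmichael⇒p-1∣ : ∀ {n q} → Carmichael (suc n) → Prime (suc q) → suc q ∣ suc n → q ∣ n
carmichael⇒p-1∣ {n} (_ , h) pr p∣N = p-1∣n pr n λ a → congruent (ℤ.∣ᵤ⇒∣ (∣-trans p∣N (h a)))

-- Take `a = p`: since `N ≥ 2`, `p * p` divides `p ^ N`, and if it divided `N` it would divide `p`
-- as well.
carmichael⇒squarefree : ∀ {N p} → Carmichael N → Prime p → p * p ∤ N
carmichael⇒squarefree {N} {p} (comp , h) pr p²∣N = contradiction (∣⇒≤ (ℤ.∣⇒∣ᵤ {+ (p * p)} {+ p} p²∣p))
  (<⇒≱ (m<m*n p p (nonTrivial⇒n>1 p)))
  where
  instance
    _ = prime⇒nonZero pr
    _ = prime⇒nonTrivial pr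
  N≡ : N ≡ 2 + (N ∸ 2)
  N≡ = sym (m+[n∸m]≡n (nonTrivial⇒n>1 N {{composite⇒nonTrivial comp}}))
  p²∣pᴺ : + (p * p) ℤ.∣ (+ p) ℤ.^ N
  p²∣pᴺ = ℤ.∣ᵤ⇒∣ (subst (p * p ∣_)
    (trans (*-assoc p p _) (cong ∣_∣ (trans (pos-^ p (2 + (N ∸ 2))) (cong ((+ p) ℤ.^_) (sym N≡)))))
    (m∣m*n (p ^ (N ∸ 2))))
  back : ∀ x y → x ℤ.- (x ℤ.- y) ≡ y
  back = ℤ-Solver.solve-∀
  p²∣p : + (p * p) ℤ.∣ + p
  p²∣p = subst (+ (p * p) ℤ.∣_) (back ((+ p) ℤ.^ N) (+ p))
    (ℤ.∣m∣n⇒∣m-n p²∣pᴺ (ℤ.∣ᵤ⇒∣ {i = (+ p) ℤ.^ N ℤ.- + p} (∣-trans p²∣N (h (+ p)))))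

-- The Carmichael number 1729.

-- Each further `q` in the exponent is absorbed by Fermat's theorem; this gives the converse half of
-- Korselt's criterion.
fermat-periodic : ∀ {q} → Prime (suc q) → ∀ a j → a ℤ.^ suc (j * q) ≈ a [mod + suc q ]
fermat-periodic pr a zero = ≈-reflexive (ℤ.^-identityʳ a)
fermat-periodic {q} pr a (suc j) =
  ≈-trans (≈-reflexive (ℤ.^-distribˡ-+-* a (suc q) (j * q)))
  (≈-trans (*-cong-≈ (fermat pr a) ≈-refl) (fermat-periodic pr a j))

prime⇒coprime-∤ : ∀ {p n} → Prime p → p ∤ n → Coprime p n
prime⇒coprime-∤ pr p∤n (d∣p , d∣n) with prime⇒irreducible pr d∣p
... | inj₁ d≡1 = d≡1
... | inj₂ refl = contradiction d∣n p∤n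

prime*∣ : ∀ {p m n} → Prime p → p ∤ m → p ∣ n → m ∣ n → p * m ∣ n
prime*∣ {p} {m} pr p∤m p∣n (divides j refl) with euclidsLemma j m pr p∣n
... | inj₁ p∣j = *-monoˡ-∣ m p∣j
... | inj₂ p∣m = contradiction p∣m p∤m

p-1∣n⇒p∣power : ∀ {q n} → Prime (suc q) → q ∣ n → ∀ a → suc q ∣ ∣ a ℤ.^ suc n ℤ.- a ∣
p-1∣n⇒p∣power pr (divides j refl) a = ℤ.∣⇒∣ᵤ (difference (fermat-periodic pr a j))

-- 1729 = 7 · 13 · 19, and 6, 12 and 18 all divide 1728 = 2⁶ · 27.
1729-carmichael : Carmichael 1729
1729-carmichael = composite {d = 7} (from-yes (7 <? 1729)) (divides 247 refl) , λ a →
  prime*∣ {7} {247} (from-yes (prime? 7)) (from-no (7 ∣? 247))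
    (p-1∣n⇒p∣power (from-yes (prime? 7)) (divides 288 refl) a)
    (prime*∣ {13} {19} (from-yes (prime? 13)) (from-no (13 ∣? 19))
      (p-1∣n⇒p∣power (from-yes (prime? 13)) (divides 144 refl) a)
      (p-1∣n⇒p∣power (from-yes (prime? 19)) (divides 96 refl) a))

27∈𝒦 : 𝒦 27
27∈𝒦 = z<s , from-no (2 ∣? 27) , 6 , 1729-carmichael

-- Shape of the prime factors.

divisors-of-2^n*k : ∀ n {k x} → x ∣ 2 ^ n * k → ∃[ m ] ∃[ d ] m ≤ n × d ∣ k × x ≡ 2 ^ m * d
divisors-of-2^n*k zero {k} {x} x∣k = 0 , x , z≤n , subst (x ∣_) (*-identityˡ k) x∣k , sym (*-identityˡ x)
divisors-of-2^n*k (suc n) {k} {x} x∣2^n*k with 2 ∣? x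
... | no 2∤x = map₂ (map₂ (map₁ m≤n⇒m≤1+n)) (divisors-of-2^n*k n (coprime-divisor
        (Coprimality.sym (prime⇒coprime-∤ prime[2] 2∤x)) (subst (x ∣_) (*-assoc 2 (2 ^ n) k) x∣2^n*k)))
... | yes (divides y refl) with divisors-of-2^n*k n {k} {y} (*-cancelˡ-∣ 2
        (subst₂ _∣_ (*-comm y 2) (*-assoc 2 (2 ^ n) k) x∣2^n*k))
...   | m , d , m≤n , d∣k , refl = suc m , d , s≤s m≤n , d∣k , double (2 ^ m) d
  where
  double : ∀ a d → a * d * 2 ≡ 2 * a * d
  double = ℕ-Solver.solve-∀

-- Fermat numbers as divisors.

small-multiple : ∀ {p} {z : ℤ} → + p ℤ.∣ z → ∣ z ∣ < p → z ≡ + 0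
small-multiple {p} {z} p∣z z<p with ∣ z ∣ in eq
... | zero = ℤ.∣i∣≡0⇒i≡0 eq
... | suc _ = contradiction (∣⇒≤ (subst (p ∣_) eq (ℤ.∣⇒∣ᵤ p∣z))) (<⇒≱ z<p)

module _ {m k : ℕ} (6≤m : 6 ≤ m) (1<k : 1 < k) (k<32 : k < 32) (2∤k : 2 ∤ k) where

  private
    p = 2 ^ m + 1

    32≤2^ : ∀ {j} → 5 ≤ j → 32 ≤ 2 ^ j
    32≤2^ = ^-monoʳ-≤ 2

    2^m≈-1 : + (2 ^ m) ≈ ℤ.-1ℤ [mod + p ]
    2^m≈-1 = congruent (ℤ.divides (+ 1) (sym (ℤ.*-identityˡ (+ p))))

    shift : ∀ n → + (2 ^ (n + m) * k) ≈ ℤ.- (+ (2 ^ n * k)) [mod + p ]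
    shift n = ≈-trans (≈-reflexive (trans (cong +_ regroup) (ℤ.pos-* (2 ^ m) (2 ^ n * k))))
      (≈-trans (*-cong-≈ {c = + (2 ^ n * k)} 2^m≈-1 ≈-refl) (≈-reflexive (ℤ.-1*i≡-i _)))
      where
      exchange : ∀ a b c → a * b * c ≡ b * (a * c)
      exchange = ℕ-Solver.solve-∀
      regroup : 2 ^ (n + m) * k ≡ 2 ^ m * (2 ^ n * k)
      regroup = trans (cong (_* k) (^-distribˡ-+-* 2 n m)) (exchange (2 ^ n) (2 ^ m) k)

    neg-cong : ∀ {a b} → ℤ.- a ≈ b [mod + p ] → a ≈ ℤ.- b [mod + p ]
    neg-cong {a} {b} h = ≈-trans (≈-reflexive (trans (sym (ℤ.neg-involutive a)) (sym (ℤ.-1*i≡-i (ℤ.- a)))))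
      (≈-trans (*-cong-≈ {a = ℤ.-1ℤ} ≈-refl h) (≈-reflexive (ℤ.-1*i≡-i b)))

    equal-abs : ∀ {a b} → a ≈ b [mod + p ] → ∣ a ∣ + ∣ b ∣ < p → ∣ a ∣ ≡ ∣ b ∣
    equal-abs {a} {b} (congruent h) small =
      cong ∣_∣ (ℤ.i-j≡0⇒i≡j a b (small-multiple h (≤-<-trans (ℤ.∣i-j∣≤∣i∣+∣j∣ a b) small)))

    -- For `r > 0`, multiply by `2 ^ s` with `s = m - r`: then `- k` is congruent to plus or minus
    -- `2 ^ s`. Both sides are too small to differ in absolute value, so the odd `k` would be
    -- `2 ^ s` with `s > 0`.
    remainder-case : ∀ r → r < m → ∀ ε → ∣ ε ∣ ≡ 1 → ¬ (+ (2 ^ r * k) ≈ ε [mod + p ])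
    remainder-case zero _ ε ∣ε∣≡1 h = <⇒≢ 1<k (sym (trans k≡ ∣ε∣≡1))
      where
      k≡ : k ≡ ∣ ε ∣
      k≡ = trans (sym (*-identityˡ k)) (equal-abs h (begin-strict
        1 * k + ∣ ε ∣ ≡⟨ cong₂ _+_ (*-identityˡ k) ∣ε∣≡1 ⟩
        k + 1         <⟨ +-monoˡ-< 1 (<-≤-trans k<32 (32≤2^ (≤-trans (n≤1+n 5) 6≤m))) ⟩
        2 ^ m + 1     ∎))
        where open ≤-Reasoning
    remainder-case r@(suc _) r<m ε ∣ε∣≡1 h = 2∤k (subst (2 ∣_) (sym k≡2^s) (2∣2^ s>0))
      where
      s = m ∸ r
      s>0 : 0 < s
      s>0 = m<n⇒0<n∸m r<m
      2∣2^ : ∀ {j} → 0 < j → 2 ∣ 2 ^ j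
      2∣2^ {suc j} _ = m∣m*n (2 ^ j)
      scaled : ℤ.- (+ k) ≈ + (2 ^ s) ℤ.* ε [mod + p ]
      scaled = ≈-trans (≈-sym (≈-trans (shift 0) (≈-reflexive (cong (λ x → ℤ.- (+ x)) (*-identityˡ k)))))
        (≈-trans (≈-reflexive (trans (cong +_ regroup) (ℤ.pos-* (2 ^ s) (2 ^ r * k))))
          (*-cong-≈ {a = + (2 ^ s)} ≈-refl h))
        where
        regroup : 2 ^ (0 + m) * k ≡ 2 ^ s * (2 ^ r * k)
        regroup = trans (cong (λ j → 2 ^ j * k) (sym (m∸n+n≡m (<⇒≤ r<m))))
          (trans (cong (_* k) (^-distribˡ-+-* 2 s r)) (*-assoc (2 ^ s) (2 ^ r) k))
      ∣rhs∣ : ∣ + (2 ^ s) ℤ.* ε ∣ ≡ 2 ^ s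
      ∣rhs∣ = trans (ℤ.abs-* (+ (2 ^ s)) ε) (trans (cong (2 ^ s *_) ∣ε∣≡1) (*-identityʳ (2 ^ s)))
      m-1 = pred m
      m≡ : m ≡ suc m-1
      m≡ = sym (suc-pred m {{>-nonZero (<-≤-trans z<s 6≤m)}})
      small : ∣ ℤ.- (+ k) ∣ + ∣ + (2 ^ s) ℤ.* ε ∣ < p
      small = begin-strict
        ∣ ℤ.- (+ k) ∣ + ∣ + (2 ^ s) ℤ.* ε ∣ ≡⟨ cong₂ _+_ (ℤ.∣-i∣≡∣i∣ (+ k)) ∣rhs∣ ⟩
        -- Both terms are at most `2 ^ (m - 1)`: the first by `k < 32` and `6 ≤ m`, the second by
        -- `s < m`.
        k + 2 ^ s                           ≤⟨ +-mono-≤ (≤-trans (<⇒≤ k<32) (32≤2^ (s≤s⁻¹ (subst (6 ≤_) m≡ 6≤m))))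
                                                 (^-monoʳ-≤ 2 (s≤s⁻¹ (subst (s <_) m≡ (∸-monoʳ-< z<s (<⇒≤ r<m))))) ⟩
        2 ^ m-1 + 2 ^ m-1                   ≡⟨ cong (λ x → 2 ^ m-1 + x) (+-identityʳ (2 ^ m-1)) ⟨
        2 ^ suc m-1                         ≡⟨ cong (2 ^_) m≡ ⟨
        2 ^ m                               <⟨ m<m+n (2 ^ m) z<s ⟩
        2 ^ m + 1                           ∎
        where open ≤-Reasoning
      k≡2^s : k ≡ 2 ^ s
      k≡2^s = trans (sym (ℤ.∣-i∣≡∣i∣ (+ k))) (trans (equal-abs scaled small) ∣rhs∣)

    -- Removing `m` from the exponent changes the sign of the residue, hence the general `ε`.
    general-case : ∀ q r → r < m → ∀ ε → ∣ ε ∣ ≡ 1 → ¬ (+ (2 ^ (r + q * m) * k) ≈ ε [mod + p ])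
    general-case zero r r<m ε unit h = remainder-case r r<m ε unit
      (subst (λ j → + (2 ^ j * k) ≈ ε [mod + p ]) (+-identityʳ r) h)
    general-case (suc q) r r<m ε unit h = general-case q r r<m (ℤ.- ε) (trans (ℤ.∣-i∣≡∣i∣ ε) unit)
      (neg-cong (≈-trans (≈-sym (shift (r + q * m)))
        (subst (λ j → + (2 ^ j * k) ≈ ε [mod + p ]) (reorder r m (q * m)) h)))
      where
      reorder : ∀ r m x → r + (m + x) ≡ r + x + m
      reorder = ℕ-Solver.solve-∀

  fermat-number-∤ : ∀ n → 2 ^ m + 1 ∤ 2 ^ n * k + 1
  fermat-number-∤ n p∣N = general-case (n / m) (n % m) (m%n<n n m) ℤ.-1ℤ refl
    (subst (λ j → + (2 ^ j * k) ≈ ℤ.-1ℤ [mod + p ]) (m≡m%n+[m/n]*n n m) (congruent (ℤ.∣ᵤ⇒∣ p∣N)))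
    where instance _ = >-nonZero (<-≤-trans z<s 6≤m)

-- The search.

isDivisor : ℕ → ℕ → Bool
isDivisor zero v = false
isDivisor (suc q) v = (v % suc q) ≡ᵇ 0

hasFactor : List ℕ → ℕ → Bool
hasFactor [] v = false
hasFactor (q ∷ qs) v = (isDivisor q v ∧ (q <ᵇ v)) ∨ hasFactor qs v

≡ᵇ-true : ∀ {a b} → (a ≡ᵇ b) ≡ true → a ≡ b
≡ᵇ-true {a} {b} eq = ≡ᵇ⇒≡ a b (subst T (sym eq) tt)

<ᵇ-true : ∀ {a b} → (a <ᵇ b) ≡ true → a < b
<ᵇ-true {a} {b} eq = <ᵇ⇒< a b (subst T (sym eq) tt)

∨-true : ∀ a {b} → a ∨ b ≡ true → a ≡ true ⊎ b ≡ true
∨-true true eq = inj₁ refl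
∨-true false eq = inj₂ eq

isDivisor-sound : ∀ q v → isDivisor q v ≡ true → q ∣ v
isDivisor-sound (suc q) v eq = m%n≡0⇒n∣m v (suc q) (≡ᵇ-true eq)

hasFactor-sound : ∀ qs v → hasFactor qs v ≡ true → ∃[ q ] q ∈ qs × q ∣ v × q < v
hasFactor-sound (q ∷ qs) v eq with ∨-true (isDivisor q v ∧ (q <ᵇ v)) eq
... | inj₁ h = q , here refl , isDivisor-sound q v (∧-conicalˡ _ _ h) , <ᵇ-true (∧-conicalʳ _ _ h)
... | inj₂ h = map₂ (map₁ there) (hasFactor-sound qs v h)

prime-divisor : ∀ Q → 1 < Q → ∃[ p ] Prime p × p ∣ Q
prime-divisor Q 1<Q with factorise Q {{>-nonZero (<-trans z<s 1<Q)}}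
... | record { factors = []; isFactorisation = refl } = contradiction 1<Q (<-irrefl refl)
... | record { factors = p ∷ ps; isFactorisation = refl; factorsPrime = pr ∷ _ } = p , pr , m∣m*n (product ps)

-- Meant for the cofactor left by the search, all of whose primes have a level above the current
-- one.
≈1-from-primes : ∀ {m} Q → .{{NonZero Q}} → (∀ p → Prime p → p ∣ Q → + p ≈ + 1 [mod m ]) → + Q ≈ + 1 [mod m ]
≈1-from-primes {m} Q h with factorise Q
... | record { factors = ps; isFactorisation = refl; factorsPrime = primes } = go ps primes h
  where
  go : ∀ ps → All Prime ps → (∀ p → Prime p → p ∣ product ps → + p ≈ + 1 [mod m ]) → + product ps ≈ + 1 [mod m ]
  go [] [] h = ≈-refl
  go (p ∷ ps) (pr ∷ prs) h = ≈-trans (≈-reflexive (ℤ.pos-* p (product ps)))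
    (*-cong-≈ {b = + 1} {d = + 1} (h p pr (m∣m*n _)) (go ps prs λ q pq q∣ → h q pq (∣n⇒∣m*n p q∣)))

∣⇒≈1 : ∀ {m a} → m ∣ a → + (a + 1) ≈ + 1 [mod + m ]
∣⇒≈1 {m} {a} m∣a = congruent (subst (+ m ℤ.∣_)
  (sym (trans (cong (ℤ._- + 1) (ℤ.+-comm (+ a) (+ 1))) (i+j-i≡j (+ 1) (+ a))))
  (ℤ.∣ᵤ⇒∣ m∣a))

≈-weaken : ∀ {m m′ a b} → m′ ∣ m → a ≈ b [mod + m ] → a ≈ b [mod + m′ ]
≈-weaken m′∣m (congruent h) = congruent (ℤ.∣-trans (ℤ.∣ᵤ⇒∣ m′∣m) h)

2^-∣ : ∀ {a b} → a ≤ b → 2 ^ a ∣ 2 ^ b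
2^-∣ {a} {b} a≤b = divides (2 ^ (b ∸ a)) (trans (cong (2 ^_) (sym (m∸n+n≡m a≤b))) (^-distribˡ-+-* 2 (b ∸ a) a))

module _ (k : ℕ) (ds : List ℕ) where

  -- The bound 64 = 2⁶ is that of fermat-factor. Only proper factors count, since w * d + 1 may itself be one of the
  -- primes in qs.
  allowed : List ℕ → ℕ → ℕ → Bool
  allowed qs w d = ((d ≡ᵇ k) ∨ (not (d ≡ᵇ 1) ∨ (w <ᵇ 64))) ∧ not (hasFactor qs (w * d + 1))

  -- explore lin qs f w s D c tells that no Candidate passes through a state at level m with P = 1 + 2ᵐc, where D lists
  -- the d still undecided at this level. If lin is false, P is exact and w = 2ᵐ; if lin is true, P is known modulo
  -- 2ᴷ with K ≤ 2m, and w is a smaller power of 2 congruent to 2ᵐ modulo all q in qs. The flag s says that m < n is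
  -- known. The fuel f bounds the number of further levels. The case c = 0, where no factor has been chosen, is void
  -- because the search starts at the lowest level.
  explore : Bool → List ℕ → ℕ → ℕ → Bool → List ℕ → ℕ → Bool
  explore lin qs f w s (d ∷ D) c = explore lin qs f w s D c ∧
    (if allowed qs w d then explore lin qs f w (s ∨ (d ≡ᵇ k)) D (c + d + (if lin then 0 else w * (c * d))) else true)
  explore lin qs f w s [] zero = true
  explore lin qs zero w s [] c@(suc _) = ((c % 2) ≡ᵇ 1) ∧ (s ∨ not (c ≡ᵇ k))
  explore lin qs (suc f) w s [] c@(suc _) =
    if (c % 2) ≡ᵇ 1 then s ∨ not (c ≡ᵇ k) else explore lin qs f (2 * w) lin ds (c / 2)

-- Soundness of the search.

-- The consequences of the Carmichael property on which the search relies. In `fermat-factor`,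
-- `k = 1` is excepted because `2 ^ m + 1` divides `2 ^ n + 1` whenever `n` is an odd multiple of
-- `m`.
record Candidate (k n N : ℕ) : Set where
  field
    N≡        : N ≡ 2 ^ n * k + 1
    2∤k       : 2 ∤ k
    ¬prime-N  : ¬ Prime N
    squarefree : ∀ {p} → Prime p → p * p ∤ N
    form      : ∀ {p} → Prime p → p ∣ N → ∃[ m ] ∃[ d ] m ≤ n × d ∣ k × p ≡ 2 ^ m * d + 1
    fermat-factor : ∀ {m} → k ≢ 1 → 2 ^ m + 1 ∣ N → m < 6

-- `offset` is the amount by which the exponent of 2 in `w` falls short of `m`. As `2 ^ offset` is 1
-- modulo each `q`, the numbers `w * d + 1` and `2 ^ m * d + 1` have the same divisors in `qs`.
module Soundness
  {k n N : ℕ} (cand : Candidate k n N)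
  (ds : List ℕ) (∈ds : ∀ {d} → d ∣ k → d ∈ ds)
  (qs : List ℕ) (offset : ℕ) (qs-ok : ∀ {q} → q ∈ qs → 1 < q × + (2 ^ offset) ≈ + 1 [mod + q ])
  (K m₀ : ℕ) {d₀ : ℕ} (d₀∣k : d₀ ∣ k) (p₀-prime : Prime (2 ^ m₀ * d₀ + 1)) (p₀∣N : 2 ^ m₀ * d₀ + 1 ∣ N)
  where

  open Candidate cand

  -- The sum `m + f` is the same at every level, so `m + f < K` keeps the modulus fine enough until
  -- the fuel is spent. `K ≤ m + m` kills products of two terms, and `K ≤ n` keeps the search below
  -- the top level.
  data Approx (P m c w f : ℕ) : Bool → Set where
    exact  : w ≡ 2 ^ m → P ≡ 1 + 2 ^ m * c → Approx P m c w f false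
    linear : m + f < K → K ≤ n → K ≤ m + m → + P ≈ + (1 + 2 ^ m * c) [mod + (2 ^ K) ] → Approx P m c w f true

  Pending : ℕ → List ℕ → ℕ → Set
  Pending m D p = ∃[ m′ ] ∃[ d ] m′ ≤ n × d ∣ k × p ≡ 2 ^ m′ * d + 1 × (m < m′ ⊎ m ≡ m′ × d ∈ D)

  -- `P` is the product of the primes chosen so far, `Q` the cofactor. The field `c≡0` is what makes
  -- an empty choice at the lowest level absurd.
  record State (lin : Bool) (m f w : ℕ) (s : Bool) (D : List ℕ) (c : ℕ) : Set where
    field
      P Q     : ℕ
      N≡PQ    : N ≡ P * Q
      pending : ∀ {p} → Prime p → p ∣ Q → Pending m D p
      m₀≤m    : m₀ ≤ m
      m≤n     : m ≤ n
      m<n     : s ≡ true → m < n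
      c≡0     : c ≡ 0 → P ≡ 1
      window  : 2 ^ m ≡ w * 2 ^ offset
      approx  : Approx P m c w f lin

  -- As `d` divides the odd `k`, `2 ^ m` is the exact power of 2 in `2 ^ m * d`.
  level-unique : ∀ {m d m′ d′} → d ∣ k → m < m′ → 2 ^ m * d + 1 ≢ 2 ^ m′ * d′ + 1
  level-unique {m} {d} {m′} {d′} d∣k m<m′ eq = 2∤k (∣-trans (divides (2 ^ j * d′) d≡) d∣k)
    where
    j = m′ ∸ suc m
    instance _ = m^n≢0 2 m
    regroup : ∀ a b d → b * (2 * a) * d ≡ a * (b * d * 2)
    regroup = ℕ-Solver.solve-∀
    d≡ : d ≡ 2 ^ j * d′ * 2
    d≡ = *-cancelˡ-≡ d _ (2 ^ m) (trans (+-cancelʳ-≡ 1 _ _ eq) (trans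
      (cong (λ i → 2 ^ i * d′) (sym (m∸n+n≡m m<m′)))
      (trans (cong (_* d′) (^-distribˡ-+-* 2 j (suc m))) (regroup (2 ^ m) (2 ^ j) d′))))

  N-nonZero : NonZero N
  N-nonZero = ≢-nonZero λ N≡0 → 1+n≢0 (trans (+-comm 1 (2 ^ n * k)) (trans (sym N≡) N≡0))

  module _ {lin m f w s c} (st : State lin m f w s [] c) where
    open State st

    later : ∀ {p} → Prime p → p ∣ Q → ∃[ m′ ] ∃[ d ] m′ ≤ n × d ∣ k × p ≡ 2 ^ m′ * d + 1 × m < m′
    later pr p∣Q with pending pr p∣Q
    ... | m′ , d , m′≤n , d∣k , eq , inj₁ m<m′ = m′ , d , m′≤n , d∣k , eq , m<m′

    -- With `P = 1` the cofactor is `N`, so the prime given by `m₀` and `d₀` would still be pending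
    -- above level `m ≥ m₀`.
    c≢0 : c ≢ 0
    c≢0 c≡0′ with later p₀-prime (subst (2 ^ m₀ * d₀ + 1 ∣_)
                    (trans N≡PQ (trans (cong (_* Q) (c≡0 c≡0′)) (*-identityˡ Q))) p₀∣N)
    ... | m′ , d , _ , _ , eq , m<m′ = level-unique d₀∣k (≤-<-trans m₀≤m m<m′) eq

    Q-nonZero : NonZero Q
    Q-nonZero = ≢-nonZero λ Q≡0 → ≢-nonZero⁻¹ N {{N-nonZero}} (trans N≡PQ (trans (cong (P *_) Q≡0) (*-zeroʳ P)))

    approx-next : + P ≈ + (1 + 2 ^ m * c) [mod + (2 ^ suc m) ]
    approx-next with approx
    ... | exact _ P≡ = ≈-reflexive (cong +_ P≡)
    ... | linear m+f<K _ _ h = ≈-weaken (2^-∣ (≤-<-trans (m≤m+n m f) m+f<K)) h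

    even : m < n → 2 ∣ c
    even m<n = *-cancelˡ-∣ (2 ^ m) {{m^n≢0 2 m}} (subst (_∣ 2 ^ m * c) (*-comm 2 (2 ^ m)) 2^∣)
      where
      Q≈1 : + Q ≈ + 1 [mod + (2 ^ suc m) ]
      Q≈1 = ≈1-from-primes Q {{Q-nonZero}} λ p pr p∣Q → case later pr p∣Q of λ where
        (m′ , d , _ , _ , refl , m<m′) → ∣⇒≈1 (∣m⇒∣m*n d (2^-∣ m<m′))
      N≈1 : + N ≈ + 1 [mod + (2 ^ suc m) ]
      N≈1 = ≈-trans (≈-reflexive (cong +_ N≡)) (∣⇒≈1 (∣m⇒∣m*n k (2^-∣ m<n)))
      P≈1 : + P ≈ + 1 [mod + (2 ^ suc m) ]
      P≈1 = ≈-trans (≈-reflexive (sym (ℤ.*-identityʳ (+ P)))) (≈-trans (*-cong-≈ {a = + P} ≈-refl (≈-sym Q≈1))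
        (≈-trans (≈-reflexive (trans (sym (ℤ.pos-* P Q)) (cong +_ (sym N≡PQ)))) N≈1))
      2^∣ : 2 ^ suc m ∣ 2 ^ m * c
      2^∣ = ℤ.∣⇒∣ᵤ {+ (2 ^ suc m)} {+ (2 ^ m * c)} (subst (+ (2 ^ suc m) ℤ.∣_) (ℤ.⊖-≥ {1 + 2 ^ m * c} {1} z<s)
        (difference (≈-trans (≈-sym approx-next) P≈1)))

    closing : (m < n × 2 ∣ c) ⊎ (s ≡ false × c ≡ k)
    closing with m≤n⇒m<n∨m≡n m≤n
    ... | inj₁ m<n = inj₁ (m<n , even m<n)
    ... | inj₂ refl = inj₂ (s≡false , c≡k)
      where
      s≡false : s ≡ false
      s≡false = ¬-not λ s≡true → <-irrefl refl (m<n s≡true)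
      Q≡1 : Q ≡ 1
      Q≡1 with m≤n⇒m<n∨m≡n (>-nonZero⁻¹ Q {{Q-nonZero}})
      ... | inj₂ 1≡Q = sym 1≡Q
      ... | inj₁ 1<Q with prime-divisor Q 1<Q
      ...   | p , pr , p∣Q with later pr p∣Q
      ...     | m′ , d , m′≤n , _ , _ , n<m′ = contradiction m′≤n (<⇒≱ n<m′)
      c≡k : c ≡ k
      c≡k with approx
      -- In linear mode the level lies strictly below `K ≤ n`, so it cannot be the top one.
      ... | linear m+f<K K≤n _ _ = contradiction K≤n (<⇒≱ (≤-<-trans (m≤m+n m f) m+f<K))
      ... | exact _ P≡ = *-cancelˡ-≡ c k (2 ^ m) {{m^n≢0 2 m}} (suc-injective (trans (sym P≡)
        (trans (sym (*-identityʳ P)) (trans (cong (P *_) (sym Q≡1)) (trans (sym N≡PQ)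
          (trans N≡ (+-comm (2 ^ m * k) 1)))))))

  advance : ∀ {lin m f w s c} → State lin m (suc f) w s [] c → m < n → 2 ∣ c →
    State lin (suc m) f (2 * w) lin ds (c / 2)
  advance {lin} {m} {f} {w} {s} {c} st m<n 2∣c = record
    { P = P ; Q = Q ; N≡PQ = N≡PQ
    ; pending = λ pr p∣Q → case later st pr p∣Q of λ where
        (m′ , d , m′≤n , d∣k , eq , m<m′) → m′ , d , m′≤n , d∣k , eq ,
          [ inj₁ , (λ m≡m′ → inj₂ (m≡m′ , ∈ds d∣k)) ]′ (m≤n⇒m<n∨m≡n m<m′)
    ; m₀≤m = m≤n⇒m≤1+n m₀≤m
    ; m≤n = m<n
    ; m<n = strict approx
    ; c≡0 = λ c/2≡0 → c≡0 (trans (sym (m/n*n≡m 2∣c)) (cong (_* 2) c/2≡0))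
    ; window = trans (cong (2 *_) window) (sym (*-assoc 2 w (2 ^ offset)))
    ; approx = approx′ approx
    }
    where
    open State st hiding (m<n)
    -- The next level takes `lin` as its flag: a linear search has `m + 1 < K ≤ n`, while an exact
    -- one starts again from false.
    strict : ∀ {lin} → Approx P m c w (suc f) lin → lin ≡ true → suc m < n
    strict (linear m+f<K K≤n _ _) refl =
      <-≤-trans (≤-<-trans (s≤s (m≤m+n m f)) (subst (_< K) (+-suc m f) m+f<K)) K≤n
    regroup : ∀ a x → a * (x * 2) ≡ 2 * a * x
    regroup = ℕ-Solver.solve-∀
    halve : 2 ^ m * c ≡ 2 ^ suc m * (c / 2)
    halve = trans (cong (2 ^ m *_) (sym (m/n*n≡m 2∣c))) (regroup (2 ^ m) (c / 2))
    approx′ : ∀ {lin} → Approx P m c w (suc f) lin → Approx P (suc m) (c / 2) (2 * w) f lin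
    approx′ (exact w≡ P≡) = exact (cong (2 *_) w≡) (trans P≡ (cong suc halve))
    approx′ (linear m+f<K K≤n K≤2m h) = linear (subst (_< K) (+-suc m f) m+f<K) K≤n
      (≤-trans K≤2m (+-mono-≤ (n≤1+n m) (n≤1+n m))) (≈-trans h (≈-reflexive (cong (λ x → + suc x) halve)))

  skip : ∀ {lin m f w s d D c} (st : State lin m f w s (d ∷ D) c) →
    ¬ (Prime (2 ^ m * d + 1) × 2 ^ m * d + 1 ∣ State.Q st) → State lin m f w s D c
  skip {m = m} {D = D} st ¬p = record
    { P = P ; Q = Q ; N≡PQ = N≡PQ ; m₀≤m = m₀≤m ; m≤n = m≤n ; m<n = m<n ; c≡0 = c≡0
    ; window = window ; approx = approx ; pending = pending′ }
    where
    open State st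
    pending′ : ∀ {p} → Prime p → p ∣ Q → Pending m D p
    pending′ pr p∣Q with pending pr p∣Q
    ... | m′ , d′ , m′≤n , d∣k , eq , inj₁ m<m′ = m′ , d′ , m′≤n , d∣k , eq , inj₁ m<m′
    ... | m′ , d′ , m′≤n , d∣k , eq , inj₂ (m≡m′ , there d′∈D) = m′ , d′ , m′≤n , d∣k , eq , inj₂ (m≡m′ , d′∈D)
    ... | m′ , d′ , m′≤n , d∣k , refl , inj₂ (refl , here refl) = contradiction (pr , p∣Q) ¬p

  module _ {lin m f w s d D c} (st : State lin m f w s (d ∷ D) c)
    (pr : Prime (2 ^ m * d + 1)) (p∣Q : 2 ^ m * d + 1 ∣ State.Q st) where
    open State st
    private
      p = 2 ^ m * d + 1
      p∣N : p ∣ N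
      p∣N = subst (p ∣_) (sym N≡PQ) (∣n⇒∣m*n P p∣Q)

    -- At the top level `2 ^ n * k + 1` is `N` itself, which is not prime.
    d≡k⇒m<n : d ≡ k → m < n
    d≡k⇒m<n refl = ≤∧≢⇒< m≤n λ { refl → ¬prime-N (subst Prime (sym N≡) pr) }

    include : State lin m f w (s ∨ (d ≡ᵇ k)) D (c + d + (if lin then 0 else w * (c * d)))
    include = record
      { P = P * p ; Q = Q′
      ; N≡PQ = trans N≡PQ (trans (cong (P *_) (trans (_∣_.equality p∣Q) (*-comm Q′ p))) (sym (*-assoc P p Q′)))
      ; pending = pending′
      ; m₀≤m = m₀≤m ; m≤n = m≤n
      ; m<n = λ eq → [ m<n , (λ d≡ᵇk → d≡k⇒m<n (≡ᵇ-true d≡ᵇk)) ]′ (∨-true s eq)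
      -- A new coefficient 0 would force `d = 0`, and then `p = 1`.
      ; c≡0 = λ c′≡0 → contradiction (subst Prime (cong (_+ 1) (trans (cong (2 ^ m *_)
          (m+n≡0⇒n≡0 c (m+n≡0⇒m≡0 (c + d) c′≡0))) (*-zeroʳ (2 ^ m)))) pr) ¬prime[1]
      ; window = window
      ; approx = approx′ approx
      }
      where
      Q′ = quotient p∣Q
      p²∣N : p ∣ Q′ → p * p ∣ N
      p²∣N p∣Q′ = subst (p * p ∣_) (sym N≡PQ) (∣n⇒∣m*n P (subst (p * p ∣_) (sym (_∣_.equality p∣Q)) (*-monoˡ-∣ p p∣Q′)))
      pending′ : ∀ {p} → Prime p → p ∣ Q′ → Pending m D p
      pending′ pr′ p′∣Q′ with pending pr′ (∣-trans p′∣Q′ (quotient-∣ p∣Q))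
      ... | m′ , d′ , m′≤n , d∣k , eq , inj₁ m<m′ = m′ , d′ , m′≤n , d∣k , eq , inj₁ m<m′
      ... | m′ , d′ , m′≤n , d∣k , eq , inj₂ (m≡m′ , there d′∈D) = m′ , d′ , m′≤n , d∣k , eq , inj₂ (m≡m′ , d′∈D)
      ... | m′ , d′ , m′≤n , d∣k , refl , inj₂ (refl , here refl) = contradiction (p²∣N p′∣Q′) (squarefree pr)
      expand : ∀ a c d → (1 + a * c) * (a * d + 1) ≡ 1 + a * (c + d + a * (c * d))
      expand = ℕ-Solver.solve-∀
      -- Separates the product term, which vanishes modulo `2 ^ K` because `K ≤ m + m`.
      split : ∀ a c d → 1 + a * (c + d + a * (c * d)) ≡ 1 + a * (c + d + 0) + c * d * (a * a)
      split = ℕ-Solver.solve-∀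
      approx′ : ∀ {lin} → Approx P m c w f lin → Approx (P * p) m (c + d + (if lin then 0 else w * (c * d))) w f lin
      approx′ (exact refl refl) = exact refl (expand (2 ^ m) c d)
      approx′ (linear m+f<K K≤n K≤2m h) = linear m+f<K K≤n K≤2m
        (≈-trans (≈-reflexive (ℤ.pos-* P p))
        (≈-trans (*-cong-≈ {c = + p} h ≈-refl)
        (≈-trans (≈-reflexive (trans (sym (ℤ.pos-* (1 + 2 ^ m * c) p))
          (cong +_ (trans (expand (2 ^ m) c d) (split (2 ^ m) c d)))))
        (congruent (subst (+ (2 ^ K) ℤ.∣_)
          (sym (trans (cong (ℤ._- + low) (ℤ.pos-+ low high)) (i+j-i≡j (+ low) (+ high)))) (ℤ.∣ᵤ⇒∣ 2^K∣high))))))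
        where
        low = 1 + 2 ^ m * (c + d + 0)
        high = c * d * (2 ^ m * 2 ^ m)
        2^K∣high : 2 ^ K ∣ high
        2^K∣high = ∣n⇒∣m*n (c * d) (subst (2 ^ K ∣_) (^-distribˡ-+-* 2 m m) (2^-∣ K≤2m))

    w≤2^m : w ≤ 2 ^ m
    w≤2^m = subst (w ≤_) (sym window) (m≤m*n w (2 ^ offset) {{m^n≢0 2 offset}})

    -- A proper divisor `q` of `w * d + 1` from `qs` would divide `p` too, by periodicity, and be
    -- smaller than `p` because `w ≤ 2 ^ m`.
    no-factor : hasFactor qs (w * d + 1) ≡ false
    no-factor with hasFactor qs (w * d + 1) in eq
    ... | false = refl
    ... | true with hasFactor-sound qs (w * d + 1) eq
    ...   | q , q∈qs , q∣v , q<v =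
        contradiction (hasNonTrivialDivisor {{n>1⇒nonTrivial 1<q}} q<p q∣p) (prime⇒¬composite pr)
      where
      1<q = proj₁ (qs-ok q∈qs)
      q<p : q < p
      q<p = <-≤-trans q<v (+-monoˡ-≤ 1 (*-monoˡ-≤ d w≤2^m))
      regroup : ∀ a b d → a * b * d ≡ b * (a * d)
      regroup = ℕ-Solver.solve-∀
      scaled : + (2 ^ m * d) ≈ + (w * d) [mod + q ]
      scaled = ≈-trans
        (≈-reflexive (trans (cong +_ (trans (cong (_* d) window) (regroup w (2 ^ offset) d)))
          (ℤ.pos-* (2 ^ offset) (w * d))))
        (≈-trans (*-cong-≈ {c = + (w * d)} (proj₂ (qs-ok q∈qs)) ≈-refl) (≈-reflexive (ℤ.*-identityˡ (+ (w * d)))))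
      p≈v : + p ≈ + (w * d + 1) [mod + q ]
      p≈v = +-cong-≈ {c = + 1} scaled ≈-refl
      restore : ∀ x y → (x ℤ.- y) ℤ.+ y ≡ x
      restore = ℤ-Solver.solve-∀
      q∣p : q ∣ p
      q∣p = ℤ.∣⇒∣ᵤ {+ q} {+ p} (subst (+ q ℤ.∣_) (restore (+ p) (+ (w * d + 1)))
        (ℤ.∣m∣n⇒∣m+n (difference p≈v) (ℤ.∣ᵤ⇒∣ q∣v)))

    is-allowed : allowed k ds qs w d ≡ true
    is-allowed = cong₂ _∧_ fermat-ok (cong not no-factor)
      where
      fermat-ok : (d ≡ᵇ k) ∨ (not (d ≡ᵇ 1) ∨ (w <ᵇ 64)) ≡ true
      fermat-ok with d ≟ k | d ≟ 1
      ... | yes d≡k | _ = cong (_∨ (not (d ≡ᵇ 1) ∨ (w <ᵇ 64))) (dec-true (d ≟ k) d≡k)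
      ... | no _ | no d≢1 =
        trans (cong (λ b → (d ≡ᵇ k) ∨ (not b ∨ (w <ᵇ 64))) (dec-false (d ≟ 1) d≢1)) (∨-zeroʳ (d ≡ᵇ k))
      ... | no d≢k | yes refl = trans (cong (λ b → (1 ≡ᵇ k) ∨ b) (dec-true (w <? 64) w<64)) (∨-zeroʳ (1 ≡ᵇ k))
        where
        w<64 : w < 64
        w<64 = ≤-<-trans w≤2^m (^-monoʳ-< 2 (s≤s (s≤s z≤n)) {m} {6} (fermat-factor (λ k≡1 → d≢k (sym k≡1))
          (subst (λ x → x + 1 ∣ N) (*-identityʳ (2 ^ m)) p∣N)))

  terminal-false : ∀ {s c} → s ≡ false → c ≡ k → s ∨ not (c ≡ᵇ k) ≢ true
  terminal-false {c = c} refl refl eq with trans (sym eq) (cong not (dec-true (c ≟ c) refl))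
  ... | ()

  no-state : ∀ {lin m} f {w s} D {c} → explore k ds lin qs f w s D c ≡ true → ¬ State lin m f w s D c
  no-state {lin} {m} f {w} {s} (d ∷ D) {c} eq st
    -- The search tries both choices for `d`; the right one depends on whether `2 ^ m * d + 1` is a
    -- prime factor of `Q`.
    with prime? (2 ^ m * d + 1) ×-dec (2 ^ m * d + 1 ∣? State.Q st)
  ... | no ¬p = no-state f D (∧-conicalˡ _ _ eq) (skip st ¬p)
  ... | yes (pr , p∣Q) = no-state f D
    (trans (sym (cong
      (λ b → if b then explore k ds lin qs f w (s ∨ (d ≡ᵇ k)) D (c + d + (if lin then 0 else w * (c * d))) else true)
      (is-allowed st pr p∣Q))) (∧-conicalʳ _ _ eq))
    (include st pr p∣Q)
  no-state f [] {zero} eq st = c≢0 st refl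
  no-state zero [] {c@(suc _)} eq st with closing st
  ... | inj₁ (_ , 2∣c) = contradiction (trans (sym (n∣m⇒m%n≡0 c 2 2∣c)) (≡ᵇ-true (∧-conicalˡ _ _ eq))) λ ()
  ... | inj₂ (s≡f , c≡k) = terminal-false s≡f c≡k (∧-conicalʳ ((c % 2) ≡ᵇ 1) _ eq)
  no-state {lin} (suc f) {w} {s} [] {c@(suc _)} eq st with closing st
  ... | inj₁ (m<n , 2∣c) = no-state f ds
    (trans (sym (cong
      (λ x → if x ≡ᵇ 1 then s ∨ not (c ≡ᵇ k) else explore k ds lin qs f (2 * w) lin ds (c / 2))
      (n∣m⇒m%n≡0 c 2 2∣c))) eq)
    (advance st m<n 2∣c)
  -- Here `c = k` is odd, so `explore` is in its odd branch, where the test fails.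
  ... | inj₂ (s≡f , c≡k) with c % 2 in c%2
  ...   | 0 = contradiction (subst (2 ∣_) c≡k (m%n≡0⇒n∣m c 2 c%2)) 2∤k
  ...   | 1 = terminal-false s≡f c≡k eq
  ...   | suc (suc _) = contradiction (subst (_< 2) c%2 (m%n<n c 2)) λ { (s≤s (s≤s ())) }

-- Parameters of the search.

-- The odd primes below 120, and larger ones for which the order of 2 divides 120 or 1260.
sievePrimes : List ℕ
sievePrimes = 3 ∷ 5 ∷ 7 ∷ 11 ∷ 13 ∷ 17 ∷ 19 ∷ 23 ∷ 29 ∷ 31 ∷ 37 ∷ 41 ∷ 43 ∷ 47 ∷ 53 ∷ 59 ∷ 61 ∷ 67 ∷ 71 ∷ 73
  ∷ 79 ∷ 83 ∷ 89 ∷ 97 ∷ 101 ∷ 103 ∷ 107 ∷ 109 ∷ 113 ∷ 127 ∷ 151 ∷ 181 ∷ 211 ∷ 241 ∷ 281 ∷ 331 ∷ 337 ∷ 421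
  ∷ 631 ∷ 1321 ∷ 1429 ∷ 2521 ∷ []

1<sievePrimes : All (1 <_) sievePrimes
1<sievePrimes = from-yes (All.all? (1 <?_) sievePrimes)

-- These periods (found by experiment) provide enough sieving primes for every search to end within 124 levels.
period : ℕ → ℕ
period k = if k ≡ᵇ 21 then 1260 else 120

period-nonZero : ∀ k → NonZero (period k)
period-nonZero k with k ≡ᵇ 21
... | true = _
... | false = _

divisors : ℕ → List ℕ
divisors k = filter (_∣? k) (upTo (suc k))

∈-divisors : ∀ {k d} → 0 < k → d ∣ k → d ∈ divisors k
∈-divisors {k} 0<k d∣k = ∈-filter⁺ (_∣? k) (∈-upTo⁺ (s≤s (∣⇒≤ {{>-nonZero 0<k}} d∣k))) d∣k

opaque
  periodicPrimes : ℕ → List ℕ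
  periodicPrimes L = filter (_∣? (2 ^ L ∸ 1)) sievePrimes

  ∈-periodicPrimes : ∀ {L q} → q ∈ periodicPrimes L → q ∈ sievePrimes × q ∣ 2 ^ L ∸ 1
  ∈-periodicPrimes {L} = ∈-filter⁻ (_∣? (2 ^ L ∸ 1)) {xs = sievePrimes}

all-∈ : ∀ {A : Set} (P : A → Bool) xs {x} → all P xs ≡ true → x ∈ xs → P x ≡ true
all-∈ P (x ∷ xs) eq (here refl) = ∧-conicalˡ (P x) _ eq
all-∈ P (x ∷ xs) eq (there x∈xs) = all-∈ P xs (∧-conicalʳ (P x) _ eq) x∈xs

-- A small start has `w = 2 ^ m₀`, so every sieving prime may be used; a large one keeps those for
-- which the order of 2 divides the period, and already knows `m₀ < n`.
exploreSmall exploreLarge : ℕ → ℕ → Bool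
exploreSmall k w = explore k (divisors k) false sievePrimes 124 w false (divisors k) 0
exploreLarge k w = explore k (divisors k) true (periodicPrimes (period k)) 124 w true (divisors k) 0

allPowers : (ℕ → Bool) → ℕ → ℕ → Bool
allPowers P b L = all (λ r → P (2 ^ (b + r))) (upTo L)

allPowers⇒ : ∀ P b L {r} → allPowers P b L ≡ true → r < L → P (2 ^ (b + r)) ≡ true
allPowers⇒ P b L {r} eq r<L = all-∈ (λ r → P (2 ^ (b + r))) (upTo L) {r} eq (∈-upTo⁺ r<L)

power-reduce : ∀ P b L m .{{_ : NonZero L}} → allPowers P b L ≡ true → b ≤ m →
  ∃[ w ] ∃[ t ] P w ≡ true × 2 ^ m ≡ w * 2 ^ (t * L)
power-reduce P b L m eq b≤m = 2 ^ (b + r) , t , allPowers⇒ P b L eq (m%n<n (m ∸ b) L) ,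
  trans (cong (2 ^_) m≡) (^-distribˡ-+-* 2 (b + r) (t * L))
  where
  r = (m ∸ b) % L
  t = (m ∸ b) / L
  m≡ : m ≡ b + r + t * L
  m≡ = trans (sym (m+[n∸m]≡n b≤m)) (trans (cong (λ x → b + x) (m≡m%n+[m/n]*n (m ∸ b) L)) (sym (+-assoc b r (t * L))))

opaque
  -- Representatives `130 + r` instead of `r` keep `w` above the Fermat bound 64 and above every
  -- sieving prime.
  refuteSmall refuteLarge : ℕ → Bool
  refuteSmall k = allPowers (exploreSmall k) 0 130
  refuteLarge k = allPowers (exploreLarge k) 130 (period k)

  refuteSmall⇒ : ∀ {k m} → refuteSmall k ≡ true → m < 130 → exploreSmall k (2 ^ m) ≡ true
  refuteSmall⇒ {k} = allPowers⇒ (exploreSmall k) 0 130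

  refuteLarge⇒ : ∀ {k m} → refuteLarge k ≡ true → 130 ≤ m →
    ∃[ w ] ∃[ t ] exploreLarge k w ≡ true × 2 ^ m ≡ w * 2 ^ (t * period k)
  refuteLarge⇒ {k} {m} = power-reduce (exploreLarge k) 130 (period k) m {{period-nonZero k}}

-- Carmichael numbers with `k` below 27.

least : ∀ {P : ℕ → Set} → Decidable P → ∀ {m} → P m → ∃[ m₀ ] P m₀ × (∀ {j} → j < m₀ → ¬ P j)
least {P} P? {m} = <-rec (λ m → P m → ∃[ m₀ ] P m₀ × (∀ {j} → j < m₀ → ¬ P j)) step m
  where
  step : ∀ m → (∀ {j} → j < m → P j → ∃[ m₀ ] P m₀ × (∀ {j} → j < m₀ → ¬ P j)) →
    P m → ∃[ m₀ ] P m₀ × (∀ {j} → j < m₀ → ¬ P j)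
  step m rec Pm with anyUpTo? P? m
  ... | yes (j , j<m , Pj) = rec j<m Pj
  ... | no none = m , Pm , λ {j} j<m Pj → none (j , j<m , Pj)

2^multiple≈1 : ∀ {q} L t → q ∣ 2 ^ L ∸ 1 → + (2 ^ (t * L)) ≈ + 1 [mod + q ]
2^multiple≈1 L t q∣ = ≈-trans (≈-reflexive (pos-^ 2 (t * L))) (power≈1 L t (≈-trans
  (≈-reflexive (trans (sym (pos-^ 2 L)) (cong +_ (sym (m∸n+n≡m (m^n>0 2 L)))))) (∣⇒≈1 q∣)))

module _ {k n : ℕ} (0<k : 0 < k) (k<27 : k < 27) (2∤k : 2 ∤ k) where

  private
    N = 2 ^ n * k + 1

  carmichael⇒candidate : Carmichael N → Candidate k n N
  carmichael⇒candidate carm = record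
    { N≡ = refl
    ; 2∤k = 2∤k
    ; ¬prime-N = composite⇒¬prime (proj₁ carm)
    ; squarefree = λ pr → carmichael⇒squarefree carm pr
    ; form = form
    ; fermat-factor = λ {m} k≢1 p∣N → ≰⇒> λ 6≤m →
        fermat-number-∤ 6≤m (≤∧≢⇒< 0<k (λ 1≡k → k≢1 (sym 1≡k))) (<-≤-trans k<27 (from-yes (27 ≤? 32))) 2∤k n p∣N
    }
    where
    form : ∀ {p} → Prime p → p ∣ N → ∃[ m ] ∃[ d ] m ≤ n × d ∣ k × p ≡ 2 ^ m * d + 1
    form {zero} pr p∣N = contradiction pr ¬prime[0]
    form {suc q} pr p∣N with divisors-of-2^n*k n {k} {q} (carmichael⇒p-1∣
        (subst Carmichael (+-comm (2 ^ n * k) 1) carm) pr (subst (suc q ∣_) (+-comm (2 ^ n * k) 1) p∣N))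
    ... | m , d , m≤n , d∣k , refl = m , d , m≤n , d∣k , +-comm 1 (2 ^ m * d)

  module _ (cand : Candidate k n N) where

    open Candidate cand

    -- The bound on `d` turns the decision into a finite search.
    Level : ℕ → Set
    Level m = m ≤ n × ∃[ d ] (d < suc k × (d ∣ k) × Prime (2 ^ m * d + 1) × (2 ^ m * d + 1) ∣ N)

    level? : Decidable Level
    level? m = m ≤? n ×-dec
      anyUpTo? (λ d → (d ∣? k) ×-dec (prime? (2 ^ m * d + 1) ×-dec ((2 ^ m * d + 1) ∣? N))) (suc k)

    level : ∀ {p} → Prime p → p ∣ N → ∃[ m ] ∃[ d ] Level m × d ∣ k × p ≡ 2 ^ m * d + 1
    level pr p∣N with form pr p∣N
    ... | m , d , m≤n , d∣k , refl = m , d , (m≤n , d , s≤s (∣⇒≤ {{>-nonZero 0<k}} d∣k) , d∣k , pr , p∣N) , d∣k , refl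

    1<N : 1 < N
    1<N = m<n+m 1 (*-mono-≤ (m^n>0 2 n) 0<k)

    module _ (small : refuteSmall k ≡ true) (large : refuteLarge k ≡ true) where

      module _ {m₀ d₀} (m₀≤n : m₀ ≤ n) (d₀∣k : d₀ ∣ k) (pr : Prime (2 ^ m₀ * d₀ + 1)) (p₀∣N : (2 ^ m₀ * d₀ + 1) ∣ N)
        (minimal : ∀ {j} → j < m₀ → ¬ Level j) where

        private
          p₀ = 2 ^ m₀ * d₀ + 1

        2^m₀<prime : ∀ {p} → Prime p → p ∣ N → 2 ^ m₀ < p
        2^m₀<prime pr′ p∣N with level pr′ p∣N
        ... | m , zero , _ , d∣k , _ = contradiction (0∣⇒≡0 d∣k) (λ k≡0 → <⇒≢ 0<k (sym k≡0))
        ... | m , d@(suc _) , Lm , d∣k , refl = begin-strict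
          2 ^ m₀        ≤⟨ ^-monoʳ-≤ 2 (≮⇒≥ λ m<m₀ → minimal m<m₀ Lm) ⟩
          2 ^ m         ≤⟨ m≤m*n (2 ^ m) d ⟩
          2 ^ m * d     <⟨ m<m+n (2 ^ m * d) z<s ⟩
          2 ^ m * d + 1 ∎
          where open ≤-Reasoning

        -- N has a second prime factor, which also exceeds 2^m₀.
        2m₀<n+5 : m₀ + m₀ < n + 5
        2m₀<n+5 = ≰⇒> λ n+5≤2m₀ → <⇒≱ (begin-strict
          N             ≤⟨ +-monoʳ-≤ (2 ^ n * k) (m^n>0 2 n) ⟩
          2 ^ n * k + 2 ^ n ≡⟨ +-comm (2 ^ n * k) (2 ^ n) ⟩
          2 ^ n + 2 ^ n * k ≡⟨ *-suc (2 ^ n) k ⟨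
          -- The 5 of the bound comes from `k + 1 ≤ 27 ≤ 2 ^ 5`.
          2 ^ n * suc k ≤⟨ *-monoʳ-≤ (2 ^ n) (≤-trans k<27 (from-yes (27 ≤? 32))) ⟩
          2 ^ n * 2 ^ 5 ≡⟨ ^-distribˡ-+-* 2 n 5 ⟨
          2 ^ (n + 5)   ≤⟨ ^-monoʳ-≤ 2 n+5≤2m₀ ⟩
          2 ^ (m₀ + m₀) ≡⟨ ^-distribˡ-+-* 2 m₀ m₀ ⟩
          2 ^ m₀ * 2 ^ m₀ <⟨ *-mono-<
            (2^m₀<prime (proj₁ (proj₂ second)) (∣-trans (proj₂ (proj₂ second)) (quotient-∣ p₀∣N)))
            (2^m₀<prime pr p₀∣N) ⟩
          proj₁ second * p₀ ≤⟨ *-monoˡ-≤ p₀ (∣⇒≤ {{>-nonZero (<-trans z<s 1<q)}} (proj₂ (proj₂ second))) ⟩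
          quotient p₀∣N * p₀ ≡⟨ _∣_.equality p₀∣N ⟨
          N             ∎) ≤-refl
          where
          open ≤-Reasoning
          1<q : 1 < quotient p₀∣N
          1<q = quotient>1 p₀∣N (≤∧≢⇒< (∣⇒≤ {{>-nonZero (<-trans z<s 1<N)}} p₀∣N)
            λ p₀≡N → ¬prime-N (subst Prime p₀≡N pr))
          second : ∃[ p ] Prime p × p ∣ quotient p₀∣N
          second = prime-divisor _ 1<q

        module _ (qs : List ℕ) (offset : ℕ)
          (qs-ok : ∀ {q} → q ∈ qs → 1 < q × + (2 ^ offset) ≈ + 1 [mod + q ]) (K : ℕ) where
          open Soundness cand (divisors k) (∈-divisors 0<k) qs offset qs-ok K m₀ d₀∣k pr p₀∣N

          start : ∀ {lin f w s} → (s ≡ true → m₀ < n) → 2 ^ m₀ ≡ w * 2 ^ offset → Approx 1 m₀ 0 w f lin →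
            State lin m₀ f w s (divisors k) 0
          start m₀<n window approx = record
            { P = 1 ; Q = N ; N≡PQ = sym (*-identityˡ N)
            ; pending = pending
            ; m₀≤m = ≤-refl ; m≤n = m₀≤n ; m<n = m₀<n ; c≡0 = λ _ → refl ; window = window ; approx = approx }
            where
            -- Minimality of `m₀` leaves no prime factor of `N` at a lower level.
            pending : ∀ {p} → Prime p → p ∣ N → Pending m₀ (divisors k) p
            pending pr′ p∣N with level pr′ p∣N
            ... | m , d , Lm , d∣k , eq = m , d , proj₁ Lm , d∣k , eq ,
              [ inj₁ , (λ m₀≡m → inj₂ (m₀≡m , ∈-divisors 0<k d∣k)) ]′ (m≤n⇒m<n∨m≡n (≮⇒≥ λ m<m₀ → minimal m<m₀ Lm))

        small-case : exploreSmall k (2 ^ m₀) ≡ true → ⊥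
        small-case eq = no-state {false} {m₀} 124 {2 ^ m₀} {false} (divisors k) {0} eq
          (start sievePrimes 0 qs-ok 0 (λ ()) (sym (*-identityʳ (2 ^ m₀)))
            (exact refl (cong suc (sym (*-zeroʳ (2 ^ m₀))))))
          where
          qs-ok : ∀ {q} → q ∈ sievePrimes → 1 < q × + (2 ^ 0) ≈ + 1 [mod + q ]
          qs-ok q∈ = All.lookup 1<sievePrimes q∈ , ≈-refl
          open Soundness cand (divisors k) (∈-divisors 0<k) sievePrimes 0 qs-ok 0 m₀ d₀∣k pr p₀∣N

        large-case : 130 ≤ m₀ → ∀ w t → exploreLarge k w ≡ true → 2 ^ m₀ ≡ w * 2 ^ (t * period k) → ⊥
        large-case 130≤m₀ w t eq window = no-state {true} {m₀} 124 {w} {true} (divisors k) {0} eq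
          (start qs offset qs-ok K (λ _ → <-≤-trans m₀<K K≤n) window
            (linear (+-monoʳ-< m₀ (n<1+n 124)) K≤n K≤2m₀ (≈-reflexive (cong (λ x → + suc x) (sym (*-zeroʳ (2 ^ m₀)))))))
          where
          qs = periodicPrimes (period k)
          offset = t * period k
          -- One more than `m₀` plus the fuel 124, since `m + f < K` is strict.
          K = m₀ + 125
          m₀<K : m₀ < K
          m₀<K = m<m+n m₀ z<s
          K≤2m₀ : K ≤ m₀ + m₀
          K≤2m₀ = +-monoʳ-≤ m₀ (≤-trans (m≤m+n 125 5) 130≤m₀)
          -- This is where 130 = 125 + 5 comes from: `m₀ + 130 ≤ m₀ + m₀ < n + 5`.
          K≤n : K ≤ n
          K≤n = +-cancelʳ-≤ 5 K n (<⇒≤ (≤-<-trans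
            (subst (_≤ m₀ + m₀) (sym (+-assoc m₀ 125 5)) (+-monoʳ-≤ m₀ 130≤m₀)) 2m₀<n+5))
          qs-ok : ∀ {q} → q ∈ qs → 1 < q × + (2 ^ offset) ≈ + 1 [mod + q ]
          qs-ok q∈ = All.lookup 1<sievePrimes (proj₁ (∈-periodicPrimes q∈)) ,
            2^multiple≈1 (period k) t (proj₂ (∈-periodicPrimes q∈))
          open Soundness cand (divisors k) (∈-divisors 0<k) qs offset qs-ok K m₀ d₀∣k pr p₀∣N

        no-lowest-level : ⊥
        no-lowest-level with m₀ <? 130
        ... | yes m₀<130 = small-case (refuteSmall⇒ small m₀<130)
        ... | no m₀≮130 =
          let w , t , eq , window = refuteLarge⇒ large (≮⇒≥ m₀≮130) in large-case (≮⇒≥ m₀≮130) w t eq window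

      ¬candidate : ⊥
      ¬candidate with prime-divisor N 1<N
      ... | p , pr , p∣N with level pr p∣N
      ...   | m , _ , Lm , _ with least level? Lm
      ...     | m₀ , (m₀≤n , d₀ , _ , d₀∣k , pr₀ , p₀∣N) , minimal = no-lowest-level {m₀} m₀≤n d₀∣k pr₀ p₀∣N minimal

-- Running the search.

refute : ℕ → Bool
refute k = isDivisor 2 k ∨ (refuteSmall k ∧ refuteLarge k)

opaque
  unfolding periodicPrimes refuteSmall

  refuted : all refute (upTo 27) ≡ true
  -- Evaluation runs the searches for each odd `k` below 27; even `k` pass by the first disjunct of
  -- `refute`.
  refuted = refl

27≤𝒦 : ∀ k → 𝒦 k → 27 ≤ k
27≤𝒦 k (0<k , 2∤k , n , carm) = ≮⇒≥ λ k<27 →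
  case ∨-true (isDivisor 2 k) (all-∈ refute (upTo 27) {k} refuted (∈-upTo⁺ k<27)) of λ where
    (inj₁ even) → 2∤k (isDivisor-sound 2 k even)
    (inj₂ eq) → ¬candidate {n = n} 0<k k<27 2∤k (carmichael⇒candidate 0<k k<27 2∤k carm)
      (∧-conicalˡ _ _ eq) (∧-conicalʳ (refuteSmall k) _ eq)

theorem2 : 27 IsSmallestElementOf 𝒦
theorem2 = 27∈𝒦 , 27≤𝒦
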